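{- Let $P$ be a finite bicolored poset with set of celeste elements $C \subseteq P$. The functions $\Omega_{P,C}(x,y)$ and $\Omega^{\circ}_{P,C}(x,y)$ are polynomials in $x$ and $y$. They satisfy the reciprocity theorem \[ (-1)^{|P|}\, \Omega^{\circ}_{P,C}(-x,-y) \;=\; \Omega_{P,C}(x,y+1). \]
   Context: For a positive integer $x$, $[x] = \{1,2,\dots,x\}$ with its usual order. A bicolored poset is a finite poset $(P,\preceq)$ thought of as the disjoint union of two subsets $C$ (the celeste elements) and $S$ (the silver elements). An order preserving $(x,y)$-map is a map $\varphi : P \to [x]$ such that $a \preceq b$ implies $\varphi(a) \le \varphi(b)$ for all $a,b \in P$, and $\varphi(c) \ge y$ for all $c \in C$. A strictly order preserving $(x,y)$-map is a map $\varphi : P \to [x]$ such that $a \prec b$ implies $\varphi(a) < \varphi(b)$ for all $a,b \in P$, and $\varphi(c) > y$ for all $c \in C$. The functions $\Omega_{P,C}(x,y)$ and $\Omega^{\circ}_{P,C}(x,y)$ count the order preserving $(x,y)$-maps and the strictly order preserving $(x,y)$-maps, respectively. In the reciprocity identity, $\Omega^{\circ}_{P,C}(-x,-y)$ means the evaluation of the polynomial at $(-x,-y)$.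
   Formalization: The counting functions are shown to agree with polynomials for x ≥ 1 and 1 ≤ y ≤ x+1 (order preserving) or 0 ≤ y ≤ x (strict); without such a range of y the claim fails, e.g. for one celeste element. The order on P is taken to be decidable. -}

module Defs where

open import Algebra.Definitions.RawSemiring using () renaming (_^_ to pow)
open import Data.Fin using (Fin; toℕ; finToFun)
import Data.Fin as Fin
open import Data.Fin.Properties using (all?)
import Data.Fin.Properties as Fin
open import Data.Fin.Subset using (Subset; _∈_; ∁)
open import Data.Fin.Subset.Properties using (_∈?_)
open import Data.Integer using (+_)
open import Data.List using (List; foldr)
open import Data.Nat using (ℕ; suc)
import Data.Nat as ℕ
open import Data.Product using (_×_)
open import Data.Rational using (ℚ; 0ℚ; _+_; _*_; _/_; +-*-rawSemiring)
open import Data.Vec using (allFin; count)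
open import Level using (Level) renaming (suc to lsuc)
open import Relation.Binary using (Rel; Decidable; IsDecPartialOrder)
import Relation.Binary.Construct.NonStrictToStrict as ToStrict
open import Relation.Binary.PropositionalEquality using (_≡_)
open import Relation.Nullary.Decidable using (Dec; _×-dec_; _→-dec_)

-- A poset with n elements, carried by Fin n. Decidability of the order is
-- classically automatic; constructively it is what makes the counts below exist.
record BicoloredPoset (n : ℕ) (ℓ : Level) : Set (lsuc ℓ) where
  infix 4 _≼_ _≺_ _≼?_ _≺?_
  field
    _≼_               : Rel (Fin n) ℓ
    isDecPartialOrder : IsDecPartialOrder _≡_ _≼_
    celeste           : Subset n

  silver : Subset n
  silver = ∁ celeste

  _≺_ : Rel (Fin n) ℓ
  _≺_ = ToStrict._<_ _≡_ _≼_

  _≼?_ : Decidable _≼_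
  _≼?_ = IsDecPartialOrder._≤?_ isDecPartialOrder

  _≺?_ : Decidable _≺_
  _≺?_ = ToStrict.<-decidable _≡_ _≼_ Fin._≟_ _≼?_

-- The chain [x] = {1, …, x} is represented by Fin x, with i standing for the
-- number suc (toℕ i).
label : ∀ {x} → Fin x → ℕ
label i = suc (toℕ i)

module _ {n ℓ} (P : BicoloredPoset n ℓ) where
  open BicoloredPoset P

  OrderPreserving : (x y : ℕ) → (Fin n → Fin x) → Set ℓ
  OrderPreserving x y φ =
    (∀ a b → a ≼ b → label (φ a) ℕ.≤ label (φ b)) ×
    (∀ c → c ∈ celeste → label (φ c) ℕ.≥ y)

  StrictlyOrderPreserving : (x y : ℕ) → (Fin n → Fin x) → Set ℓ
  StrictlyOrderPreserving x y φ =
    (∀ a b → a ≺ b → label (φ a) ℕ.< label (φ b)) ×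
    (∀ c → c ∈ celeste → label (φ c) ℕ.> y)

  orderPreserving? : ∀ x y φ → Dec (OrderPreserving x y φ)
  orderPreserving? x y φ =
    all? (λ a → all? λ b → (a ≼? b) →-dec (label (φ a) ℕ.≤? label (φ b)))
    ×-dec all? (λ c → (c ∈? celeste) →-dec (y ℕ.≤? label (φ c)))

  strictlyOrderPreserving? : ∀ x y φ → Dec (StrictlyOrderPreserving x y φ)
  strictlyOrderPreserving? x y φ =
    all? (λ a → all? λ b → (a ≺? b) →-dec (label (φ a) ℕ.<? label (φ b)))
    ×-dec all? (λ c → (c ∈? celeste) →-dec (y ℕ.<? label (φ c)))

  -- finToFun, with inverse funToFin, enumerates the x ^ n maps from P to [x]
  -- without repetition.
  Ω : (x y : ℕ) → ℕ
  Ω x y = count (λ i → orderPreserving? x y (finToFun i)) (allFin (x ℕ.^ n))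

  Ω° : (x y : ℕ) → ℕ
  Ω° x y = count (λ i → strictlyOrderPreserving? x y (finToFun i)) (allFin (x ℕ.^ n))

infixr 8 _^_
_^_ : ℚ → ℕ → ℚ
_^_ = pow +-*-rawSemiring

fromℕ : ℕ → ℚ
fromℕ k = + k / 1

-- Polynomials by their coefficients, constant term first; trailing zero
-- coefficients are allowed.
ℚ[X] : Set
ℚ[X] = List ℚ

eval : ℚ[X] → ℚ → ℚ
eval p x = foldr (λ a r → a + x * r) 0ℚ p

-- ℚ[X,Y] = ℚ[X][Y]: the j-th entry is the coefficient of Yʲ.
ℚ[X,Y] : Set
ℚ[X,Y] = List ℚ[X]

eval₂ : ℚ[X,Y] → ℚ → ℚ → ℚ
eval₂ p x y = foldr (λ a r → eval a x + y * r) 0ℚ p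

-- The counting functions agree with polynomials only while y stays within the
-- chain: one celeste element has Ω x y = x - y + 1 for 1 ≤ y ≤ x + 1 but
-- Ω x 0 = x, and Ω° x y = x - y only for y ≤ x. Both ranges are Zariski dense,
-- so each of the two predicates below holds of at most one polynomial function.
module _ {n ℓ} (P : BicoloredPoset n ℓ) where

  IsOrderPolynomial : ℚ[X,Y] → Set
  IsOrderPolynomial p = ∀ x y → 1 ℕ.≤ x → 1 ℕ.≤ y → y ℕ.≤ suc x →
    eval₂ p (fromℕ x) (fromℕ y) ≡ fromℕ (Ω P x y)

  IsStrictOrderPolynomial : ℚ[X,Y] → Set
  IsStrictOrderPolynomial p = ∀ x y → 1 ℕ.≤ x → y ℕ.≤ x →
    eval₂ p (fromℕ x) (fromℕ y) ≡ fromℕ (Ω° P x y)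

{-# OPTIONS --safe #-}

-- Removing the elements with the greatest label, one label at a time, turns
-- labellings into chains of subsets of P. Let Z B A = 1 if A ∖ B is an up-set
-- of A, let Z° B A = 1 if A ∖ B moreover is an antichain, and let D project to
-- the subsets without celeste elements. With δ the indicator of the empty set,
--   Ω (t + s) (s + 1) = (Zᵗ D Zˢ δ) ⊤   and   Ω° (t + s) s = (Z°ᵗ D Z°ˢ δ) ⊤.
-- Z is unipotent, so Newton's binomial series makes Zᵗ polynomial in t ∈ ℚ, and
-- Z⁻¹ = σ Z° σ for the diagonal matrix σ of signs (-1)^|A|. Since σ and D
-- commute, the strict count is the weak one at negated exponents, up to (-1)ⁿ.

module Submission where

open import Defs
open import Algebra.Bundles using (CommutativeRing)
open import Data.Bool using (Bool; true; false; not; if_then_else_)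
open import Data.Bool.Properties using (not-involutive)
open import Data.Fin as Fin using (Fin; zero; suc; toℕ; finToFun; combine)
open import Data.Fin.Induction using (po-noetherian)
open import Data.Fin.Properties using (all?; any?; remQuot-combine)
open import Data.Fin.Subset using (Subset; ⊤; _∈_; _∉_; _⊆_; ∣_∣; inside; outside)
open import Data.Fin.Subset.Properties using (_∈?_; _⊆?_; ⊆-antisym; ∈⊤; p⊆q⇒∣p∣≤∣q∣; drop-∷-⊆; ∣p∣≤n)
import Data.Integer as ℤ
import Data.Integer.Properties as ℤ
open import Data.List using (List; []; _∷_; _++_; map; foldr; cartesianProductWith; downFrom)
import Data.List.Membership.Propositional as List
open import Data.List.Membership.Propositional.Properties using (∈-cartesianProductWith⁻; ∈-downFrom⁻)
open import Data.List.Relation.Unary.Any using (here; there)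
open import Data.Nat as ℕ using (ℕ; zero; suc; z≤n; s≤s)
import Data.Nat.Properties as ℕ
open import Data.Product using (_×_; _,_; proj₁; proj₂; ∃-syntax)
open import Data.Rational using (ℚ; 0ℚ; 1ℚ; _+_; _*_; -_; _-_; _/_; toℚᵘ)
open import Data.Rational.Properties
open import Data.Rational.Solver using (module +-*-Solver)
import Data.Rational.Unnormalised as ℚᵘ
import Data.Rational.Unnormalised.Properties as ℚᵘ
open import Data.Vec using (Vec; []; _∷_; replicate; zipWith; lookup; tabulate; count; allFin; updateAt; here; there)
open import Data.Vec.Properties using (updateAt-updateAt; updateAt-id-local; updateAt-minimal; lookup∘tabulate; tabulate-cong)
open import Function using (id; _∘_)
open import Induction.WellFounded using (Acc; acc)
open import Level using (Level; 0ℓ)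
open import Relation.Binary using (Rel; Decidable; IsDecPartialOrder)
open import Relation.Binary.PropositionalEquality
open import Relation.Nullary using (Dec; yes; no; does; ¬_; contradiction)
open import Relation.Nullary.Decidable using (_×-dec_; _→-dec_; ¬?)

open import Algebra.Properties.Semiring.Sum (CommutativeRing.semiring +-*-commutativeRing) using (sum; sum-cong-≗)
open +-*-Solver

-- Reciprocity is asserted at rational arguments, while the counts speak of naturals only. No
-- density argument bridges the two: both polynomials come from the single function `twoStage` of t,
-- s ∈ ℚ, and the strict one is by construction its value at negated exponents, times (-1)ⁿ.
-- Reciprocity is then a substitution of arguments, and the combinatorial content lies in showing
-- that this polynomial counts the strict maps. That rests on σ Z° σ Z = 1. The entry at (E, A) sums
-- (-1)^|A ∖ B| over the B with E ⊆ B ⊆ A such that A ∖ B consists of maximal elements of A and B ∖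
-- E is an up-set of B. Toggling one fixed maximal element of A outside E preserves these conditions
-- and flips the sign; if there is no such element, some B exists only when E = A.

private variable
  A B : Set
  n : ℕ

-- Rational arithmetic and binomial coefficients

fromℕ-homo-+ : ∀ m k → fromℕ (m ℕ.+ k) ≡ fromℕ m + fromℕ k
fromℕ-homo-+ m k = toℚᵘ-injective (begin
    toℚᵘ (fromℕ (m ℕ.+ k))              ≈⟨ toℚᵘ-fromℚᵘ (num (m ℕ.+ k)) ⟩
    num (m ℕ.+ k)                       ≈⟨ ℚᵘ.*≡* (cong₂ ℤ._*_ numerators refl) ⟩
    num m ℚᵘ.+ num k                    ≈⟨ ℚᵘ.+-cong (toℚᵘ-fromℚᵘ (num m)) (toℚᵘ-fromℚᵘ (num k)) ⟨
    toℚᵘ (fromℕ m) ℚᵘ.+ toℚᵘ (fromℕ k)  ≈⟨ toℚᵘ-homo-+ (fromℕ m) (fromℕ k) ⟨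
    toℚᵘ (fromℕ m + fromℕ k)            ∎)
  where
  open import Relation.Binary.Reasoning.Setoid ℚᵘ.≃-setoid
  num : ℕ → ℚᵘ.ℚᵘ
  num i = ℚᵘ.mkℚᵘ (ℤ.+ i) 0
  numerators : ℤ.+ (m ℕ.+ k) ≡ (ℤ.+ m) ℤ.* (ℤ.+ 1) ℤ.+ (ℤ.+ k) ℤ.* (ℤ.+ 1)
  numerators = sym (cong₂ ℤ._+_ (ℤ.*-identityʳ (ℤ.+ m)) (ℤ.*-identityʳ (ℤ.+ k)))

inv : ℕ → ℚ
inv k = ℤ.+ 1 / suc k

fromℕ-inv : ∀ k → fromℕ (suc k) * inv k ≡ 1ℚ
fromℕ-inv k = toℚᵘ-injective (begin
    toℚᵘ (fromℕ (suc k) * inv k)                 ≈⟨ toℚᵘ-homo-* (fromℕ (suc k)) (inv k) ⟩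
    toℚᵘ (fromℕ (suc k)) ℚᵘ.* toℚᵘ (inv k)       ≈⟨ ℚᵘ.*-cong (toℚᵘ-fromℚᵘ (ℚᵘ.mkℚᵘ (ℤ.+ suc k) 0)) (toℚᵘ-fromℚᵘ (ℚᵘ.mkℚᵘ (ℤ.+ 1) k)) ⟩
    ℚᵘ.mkℚᵘ (ℤ.+ suc k) 0 ℚᵘ.* ℚᵘ.mkℚᵘ (ℤ.+ 1) k ≈⟨ ℚᵘ.*≡* cross ⟩
    ℚᵘ.1ℚᵘ                                       ∎)
  where
  open import Relation.Binary.Reasoning.Setoid ℚᵘ.≃-setoid
  cross : ((ℤ.+ suc k) ℤ.* (ℤ.+ 1)) ℤ.* (ℤ.+ 1) ≡ (ℤ.+ 1) ℤ.* (ℤ.+ (1 ℕ.* suc k))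
  cross = trans (ℤ.*-identityʳ _) (trans (ℤ.*-identityʳ _)
            (sym (trans (ℤ.*-identityˡ (ℤ.+ (1 ℕ.* suc k))) (cong ℤ.+_ (ℕ.*-identityˡ (suc k))))))

open ≡-Reasoning

binom : ℚ → ℕ → ℚ
binom t zero    = 1ℚ
binom t (suc k) = binom t k * ((t - fromℕ k) * inv k)

binom-0 : ∀ k → binom 0ℚ (suc k) ≡ 0ℚ
binom-0 zero    = refl
binom-0 (suc k) = trans (cong (_* c) (binom-0 k)) (*-zeroˡ c)
  where c = (0ℚ - fromℕ (suc k)) * inv (suc k)

-- Serves Pascal's rule: the recursion of `binom` moves k at fixed t, and this links t + 1 to t. For
-- rational t there are no factorials to cancel, hence the induction on k.
binom-absorb : ∀ t k → binom (t + 1ℚ) k * (t + 1ℚ - fromℕ k) ≡ (t + 1ℚ) * binom t k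
binom-absorb t zero    = solve 1 (λ t → con 1ℚ :* (t :+ con 1ℚ :- con 0ℚ) := (t :+ con 1ℚ) :* con 1ℚ) refl t
binom-absorb t (suc k) = begin
  b′ * ((t + 1ℚ - K) * r) * (t + 1ℚ - fromℕ (suc k))
    ≡⟨ cong (λ z → b′ * ((t + 1ℚ - K) * r) * (t + 1ℚ - z)) (fromℕ-homo-+ 1 k) ⟩
  b′ * ((t + 1ℚ - K) * r) * (t + 1ℚ - (1ℚ + K))
    ≡⟨ solve 4 (λ b′ t K r → b′ :* ((t :+ con 1ℚ :- K) :* r) :* (t :+ con 1ℚ :- (con 1ℚ :+ K))
                 := b′ :* (t :+ con 1ℚ :- K) :* ((t :- K) :* r)) refl b′ t K r ⟩
  b′ * (t + 1ℚ - K) * ((t - K) * r)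
    ≡⟨ cong (_* ((t - K) * r)) (binom-absorb t k) ⟩
  (t + 1ℚ) * binom t k * ((t - K) * r)
    ≡⟨ *-assoc (t + 1ℚ) (binom t k) ((t - K) * r) ⟩
  (t + 1ℚ) * binom t (suc k) ∎
  where
  b′ = binom (t + 1ℚ) k
  K = fromℕ k
  r = inv k

binom-pascal : ∀ t k → binom (t + 1ℚ) (suc k) ≡ binom t (suc k) + binom t k
binom-pascal t k = begin
  b′ * ((t + 1ℚ - K) * r)
    ≡⟨ *-assoc b′ (t + 1ℚ - K) r ⟨
  b′ * (t + 1ℚ - K) * r
    ≡⟨ cong (_* r) (binom-absorb t k) ⟩
  (t + 1ℚ) * b * r
    -- Split t + 1 as (t - k) + (1 + k): the first part gives the next coefficient, the second
    -- cancels against `r`.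
    ≡⟨ solve 4 (λ b t K r → (t :+ con 1ℚ) :* b :* r := b :* ((t :- K) :* r) :+ b :* ((con 1ℚ :+ K) :* r)) refl b t K r ⟩
  b * ((t - K) * r) + b * ((1ℚ + K) * r)
    ≡⟨ cong (λ z → b * ((t - K) * r) + b * z) (trans (cong (_* r) (sym (fromℕ-homo-+ 1 k))) (fromℕ-inv k)) ⟩
  b * ((t - K) * r) + b * 1ℚ
    ≡⟨ cong (λ z → b * ((t - K) * r) + z) (*-identityʳ b) ⟩
  binom t (suc k) + b ∎
  where
  b′ = binom (t + 1ℚ) k
  b = binom t k
  K = fromℕ k
  r = inv k

-- Polynomial functions of two variables

-- Coefficient lists with trailing zeros obey the ring laws only up to evaluation, so the
-- coefficients need no ring structure, only an `ev` that respects the operations. Thus one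
-- development serves ℚ[X] and then ℚ[X][Y].
module Coefficients {A : Set} (zeroᴬ : A) (_⊕_ _⊗_ : A → A → A) where

  add : List A → List A → List A
  add []      q       = q
  add (a ∷ p) []      = a ∷ p
  add (a ∷ p) (b ∷ q) = (a ⊕ b) ∷ add p q

  scale : A → List A → List A
  scale a = map (a ⊗_)

  mul : List A → List A → List A
  mul []      q = []
  mul (a ∷ p) q = add (scale a q) (zeroᴬ ∷ mul p q)

  module _ (ev : A → ℚ)
           (ev-zero : ev zeroᴬ ≡ 0ℚ)
           (ev-⊕ : ∀ a b → ev (a ⊕ b) ≡ ev a + ev b)
           (ev-⊗ : ∀ a b → ev (a ⊗ b) ≡ ev a * ev b)
           (y : ℚ) where

    horner : List A → ℚ
    horner = foldr (λ a r → ev a + y * r) 0ℚ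

    horner-add : ∀ p q → horner (add p q) ≡ horner p + horner q
    horner-add []      q       = sym (+-identityˡ (horner q))
    horner-add (a ∷ p) []      = sym (+-identityʳ (horner (a ∷ p)))
    horner-add (a ∷ p) (b ∷ q) = begin
      ev (a ⊕ b) + y * horner (add p q)
        ≡⟨ cong₂ (λ u v → u + y * v) (ev-⊕ a b) (horner-add p q) ⟩
      ev a + ev b + y * (horner p + horner q)
        ≡⟨ solve 5 (λ a b y p q → a :+ b :+ y :* (p :+ q) := (a :+ y :* p) :+ (b :+ y :* q)) refl
             (ev a) (ev b) y (horner p) (horner q) ⟩
      ev a + y * horner p + (ev b + y * horner q) ∎

    horner-scale : ∀ a q → horner (scale a q) ≡ ev a * horner q
    horner-scale a []      = sym (*-zeroʳ (ev a))
    horner-scale a (b ∷ q) = begin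
      ev (a ⊗ b) + y * horner (scale a q)
        ≡⟨ cong₂ (λ u v → u + y * v) (ev-⊗ a b) (horner-scale a q) ⟩
      ev a * ev b + y * (ev a * horner q)
        ≡⟨ solve 4 (λ a b y q → a :* b :+ y :* (a :* q) := a :* (b :+ y :* q)) refl
             (ev a) (ev b) y (horner q) ⟩
      ev a * (ev b + y * horner q) ∎

    horner-mul : ∀ p q → horner (mul p q) ≡ horner p * horner q
    horner-mul []      q = sym (*-zeroˡ (horner q))
    horner-mul (a ∷ p) q = begin
      horner (add (scale a q) (zeroᴬ ∷ mul p q))
        ≡⟨ horner-add (scale a q) (zeroᴬ ∷ mul p q) ⟩
      horner (scale a q) + (ev zeroᴬ + y * horner (mul p q))
        ≡⟨ cong₂ _+_ (horner-scale a q) (cong₂ (λ u v → u + y * v) ev-zero (horner-mul p q)) ⟩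
      ev a * horner q + (0ℚ + y * (horner p * horner q))
        ≡⟨ solve 4 (λ a y p q → a :* q :+ (con 0ℚ :+ y :* (p :* q)) := (a :+ y :* p) :* q) refl
             (ev a) y (horner p) (horner q) ⟩
      (ev a + y * horner p) * horner q ∎

module Poly₁ = Coefficients 0ℚ _+_ _*_
module Poly₂ = Coefficients [] Poly₁.add Poly₁.mul

eval-add : ∀ p q x → eval (Poly₁.add p q) x ≡ eval p x + eval q x
eval-add p q x = Poly₁.horner-add id refl (λ _ _ → refl) (λ _ _ → refl) x p q

eval-mul : ∀ p q x → eval (Poly₁.mul p q) x ≡ eval p x * eval q x
eval-mul p q x = Poly₁.horner-mul id refl (λ _ _ → refl) (λ _ _ → refl) x p q

-- Polynomiality is a property of the function, with the coefficients as witness; the closure rules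
-- below then assemble the order polynomials without explicit coefficients.
IsPolynomial : (ℚ → ℚ → ℚ) → Set
IsPolynomial F = ∃[ p ] (∀ x y → eval₂ p x y ≡ F x y)

infixl 6 _+ᵖ_ _-ᵖ_
infixl 7 _*ᵖ_

_+ᵖ_ : ∀ {F G} → IsPolynomial F → IsPolynomial G → IsPolynomial (λ x y → F x y + G x y)
(p , p≡F) +ᵖ (q , q≡G) = Poly₂.add p q , λ x y →
  trans (Poly₂.horner-add (λ a → eval a x) refl (λ a b → eval-add a b x) (λ a b → eval-mul a b x) y p q)
        (cong₂ _+_ (p≡F x y) (q≡G x y))

_*ᵖ_ : ∀ {F G} → IsPolynomial F → IsPolynomial G → IsPolynomial (λ x y → F x y * G x y)
(p , p≡F) *ᵖ (q , q≡G) = Poly₂.mul p q , λ x y →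
  trans (Poly₂.horner-mul (λ a → eval a x) refl (λ a b → eval-add a b x) (λ a b → eval-mul a b x) y p q)
        (cong₂ _*_ (p≡F x y) (q≡G x y))

constᵖ : ∀ c → IsPolynomial (λ _ _ → c)
constᵖ c = (c ∷ []) ∷ [] , λ x y →
  solve 3 (λ c x y → c :+ x :* con 0ℚ :+ y :* con 0ℚ := c) refl c x y

Xᵖ : IsPolynomial (λ x _ → x)
Xᵖ = (0ℚ ∷ 1ℚ ∷ []) ∷ [] , λ x y →
  solve 2 (λ x y → con 0ℚ :+ x :* (con 1ℚ :+ x :* con 0ℚ) :+ y :* con 0ℚ := x) refl x y

Yᵖ : IsPolynomial (λ _ y → y)
Yᵖ = [] ∷ (1ℚ ∷ []) ∷ [] , λ x y →
  solve 2 (λ x y → con 0ℚ :+ y :* (con 1ℚ :+ x :* con 0ℚ :+ y :* con 0ℚ) := y) refl x y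

respᵖ : ∀ {F G} → (∀ x y → F x y ≡ G x y) → IsPolynomial F → IsPolynomial G
respᵖ F≡G (p , p≡F) = p , λ x y → trans (p≡F x y) (F≡G x y)

-ᵖ_ : ∀ {F} → IsPolynomial F → IsPolynomial (λ x y → - F x y)
-ᵖ_ {F} p = respᵖ (λ x y → solve 1 (λ f → con (- 1ℚ) :* f := :- f) refl (F x y)) (constᵖ (- 1ℚ) *ᵖ p)

_-ᵖ_ : ∀ {F G} → IsPolynomial F → IsPolynomial G → IsPolynomial (λ x y → F x y - G x y)
p -ᵖ q = p +ᵖ (-ᵖ q)

binomᵖ : ∀ {F} → IsPolynomial F → ∀ k → IsPolynomial (λ x y → binom (F x y) k)
binomᵖ p zero    = constᵖ 1ℚ
binomᵖ p (suc k) = binomᵖ p k *ᵖ ((p -ᵖ constᵖ (fromℕ k)) *ᵖ constᵖ (inv k))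

-- Sums over lists and over subsets

∑ : List A → (A → ℚ) → ℚ
∑ []       f = 0ℚ
∑ (x ∷ xs) f = f x + ∑ xs f

∑-cong : ∀ {f g : A → ℚ} xs → (∀ {x} → x List.∈ xs → f x ≡ g x) → ∑ xs f ≡ ∑ xs g
∑-cong []       f≡g = refl
∑-cong (x ∷ xs) f≡g = cong₂ _+_ (f≡g (here refl)) (∑-cong xs (f≡g ∘ there))

∑-zero : ∀ {f : A → ℚ} xs → (∀ {x} → x List.∈ xs → f x ≡ 0ℚ) → ∑ xs f ≡ 0ℚ
∑-zero []       f≡0 = refl
∑-zero (x ∷ xs) f≡0 = cong₂ _+_ (f≡0 (here refl)) (∑-zero xs (f≡0 ∘ there))

∑-+ : ∀ (f g : A → ℚ) xs → ∑ xs (λ x → f x + g x) ≡ ∑ xs f + ∑ xs g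
∑-+ f g []       = refl
∑-+ f g (x ∷ xs) = begin
  f x + g x + ∑ xs (λ x → f x + g x)  ≡⟨ cong (f x + g x +_) (∑-+ f g xs) ⟩
  f x + g x + (∑ xs f + ∑ xs g)       ≡⟨ solve 4 (λ a b c d → a :+ b :+ (c :+ d) := (a :+ c) :+ (b :+ d)) refl
                                           (f x) (g x) (∑ xs f) (∑ xs g) ⟩
  f x + ∑ xs f + (g x + ∑ xs g)       ∎

∑-*ˡ : ∀ c (f : A → ℚ) xs → ∑ xs (λ x → c * f x) ≡ c * ∑ xs f
∑-*ˡ c f []       = sym (*-zeroʳ c)
∑-*ˡ c f (x ∷ xs) = trans (cong (c * f x +_) (∑-*ˡ c f xs)) (sym (*-distribˡ-+ c (f x) (∑ xs f)))

∑-swap : ∀ (f : A → B → ℚ) xs ys → ∑ xs (λ x → ∑ ys (f x)) ≡ ∑ ys (λ y → ∑ xs (λ x → f x y))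
∑-swap f []       ys = sym (∑-zero ys (λ _ → refl))
∑-swap f (x ∷ xs) ys = trans (cong (∑ ys (f x) +_) (∑-swap f xs ys)) (sym (∑-+ (f x) _ ys))

∑-++ : ∀ (f : A → ℚ) xs ys → ∑ (xs ++ ys) f ≡ ∑ xs f + ∑ ys f
∑-++ f []       ys = sym (+-identityˡ (∑ ys f))
∑-++ f (x ∷ xs) ys = trans (cong (f x +_) (∑-++ f xs ys)) (sym (+-assoc (f x) (∑ xs f) (∑ ys f)))

∑-map : ∀ (f : B → ℚ) (h : A → B) xs → ∑ (map h xs) f ≡ ∑ xs (f ∘ h)
∑-map f h []       = refl
∑-map f h (x ∷ xs) = cong (f (h x) +_) (∑-map f h xs)

∑ᵖ : ∀ (xs : List A) {F : A → ℚ → ℚ → ℚ} → (∀ a → IsPolynomial (F a)) →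
     IsPolynomial (λ x y → ∑ xs λ a → F a x y)
∑ᵖ []       p = constᵖ 0ℚ
∑ᵖ (a ∷ xs) p = p a +ᵖ ∑ᵖ xs p

∏ : Vec (List A) n → List (Vec A n)
∏ []       = [] ∷ []
∏ (l ∷ ls) = cartesianProductWith _∷_ l (∏ ls)

∑-∏ : ∀ (f : Vec A (suc n) → ℚ) l ls → ∑ (∏ (l ∷ ls)) f ≡ ∑ l (λ a → ∑ (∏ ls) (f ∘ (a ∷_)))
∑-∏ f []      ls = refl
∑-∏ f (a ∷ l) ls = trans (∑-++ f (map (a ∷_) (∏ ls)) (∏ (l ∷ ls)))
                         (cong₂ _+_ (∑-map f (a ∷_) (∏ ls)) (∑-∏ f l ls))

subsets : ∀ n → List (Subset n)
subsets n = ∏ (replicate n (true ∷ false ∷ []))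

∑ˢ : (Subset n → ℚ) → ℚ
∑ˢ {n} = ∑ (subsets n)

∑ˢ-cong : ∀ {f g : Subset n → ℚ} → (∀ B → f B ≡ g B) → ∑ˢ f ≡ ∑ˢ g
∑ˢ-cong f≡g = ∑-cong (subsets _) (λ {B} _ → f≡g B)

∑ˢ-suc : (f : Subset (suc n) → ℚ) → ∑ˢ f ≡ ∑ˢ (f ∘ (true ∷_)) + ∑ˢ (f ∘ (false ∷_))
∑ˢ-suc {n} f = trans (∑-∏ f (true ∷ false ∷ []) (replicate n (true ∷ false ∷ []))) (cong (∑ˢ (f ∘ (true ∷_)) +_) (+-identityʳ (∑ˢ (f ∘ (false ∷_)))))

∑ˢ-zero : ∀ {f : Subset n → ℚ} → (∀ B → f B ≡ 0ℚ) → ∑ˢ f ≡ 0ℚ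
∑ˢ-zero f≡0 = ∑-zero (subsets _) (λ {B} _ → f≡0 B)

∑ˢ-point : ∀ (f : Subset n → ℚ) A → (∀ B → B ≢ A → f B ≡ 0ℚ) → ∑ˢ f ≡ f A
∑ˢ-point f []          off = +-identityʳ (f [])
∑ˢ-point f (true ∷ A)  off = begin
  ∑ˢ f                                         ≡⟨ ∑ˢ-suc f ⟩
  ∑ˢ (f ∘ (true ∷_)) + ∑ˢ (f ∘ (false ∷_))     ≡⟨ cong₂ _+_ (∑ˢ-point (f ∘ (true ∷_)) A (λ B B≢A → off (true ∷ B) (λ { refl → B≢A refl })))
                                                            (∑ˢ-zero (λ B → off (false ∷ B) (λ ()))) ⟩
  f (true ∷ A) + 0ℚ                            ≡⟨ +-identityʳ _ ⟩
  f (true ∷ A)                                 ∎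
∑ˢ-point f (false ∷ A) off = begin
  ∑ˢ f                                         ≡⟨ ∑ˢ-suc f ⟩
  ∑ˢ (f ∘ (true ∷_)) + ∑ˢ (f ∘ (false ∷_))     ≡⟨ cong₂ _+_ (∑ˢ-zero (λ B → off (true ∷ B) (λ ())))
                                                            (∑ˢ-point (f ∘ (false ∷_)) A (λ B B≢A → off (false ∷ B) (λ { refl → B≢A refl }))) ⟩
  0ℚ + f (false ∷ A)                           ≡⟨ +-identityˡ _ ⟩
  f (false ∷ A)                                ∎

-- Sign-reversing involutions on subsets

toggle : Fin n → Subset n → Subset n
toggle i B = updateAt B i not

toggle-involutive : ∀ i (B : Subset n) → toggle i (toggle i B) ≡ B
toggle-involutive i B = trans (updateAt-updateAt i B) (updateAt-id-local i B (not-involutive (lookup B i)))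

∈-toggle⁺ : ∀ {i j} (B : Subset n) → j ≢ i → j ∈ B → j ∈ toggle i B
∈-toggle⁺ {i = i} {j} B j≢i = updateAt-minimal j i B j≢i

∈-toggle⁻ : ∀ {i j} (B : Subset n) → j ≢ i → j ∈ toggle i B → j ∈ B
∈-toggle⁻ {i = i} {j} B j≢i j∈ = subst (j ∈_) (toggle-involutive i B) (∈-toggle⁺ (toggle i B) j≢i j∈)

-- Splitting the sum at coordinate `i` puts each `B` next to its toggle, so neither a reindexing nor
-- a division by 2 is needed.
∑ˢ-toggle : ∀ (f : Subset n → ℚ) i → (∀ B → f B + f (toggle i B) ≡ 0ℚ) → ∑ˢ f ≡ 0ℚ
∑ˢ-toggle f zero    cancel = begin
  ∑ˢ f                                       ≡⟨ ∑ˢ-suc f ⟩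
  ∑ˢ (f ∘ (true ∷_)) + ∑ˢ (f ∘ (false ∷_))   ≡⟨ ∑-+ (f ∘ (true ∷_)) (f ∘ (false ∷_)) (subsets _) ⟨
  ∑ˢ (λ B → f (true ∷ B) + f (false ∷ B))    ≡⟨ ∑ˢ-zero (λ B → cancel (true ∷ B)) ⟩
  0ℚ                                         ∎
∑ˢ-toggle f (suc i) cancel = trans (∑ˢ-suc f)
  (cong₂ _+_ (∑ˢ-toggle (f ∘ (true ∷_)) i (cancel ∘ (true ∷_)))
             (∑ˢ-toggle (f ∘ (false ∷_)) i (cancel ∘ (false ∷_))))

sign : Subset n → ℚ
sign []          = 1ℚ
sign (true ∷ A)  = - 1ℚ * sign A
sign (false ∷ A) = sign A

sign-⊤ : ∀ n → sign (⊤ {n}) ≡ (- 1ℚ) ^ n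
sign-⊤ zero    = refl
sign-⊤ (suc n) = cong (- 1ℚ *_) (sign-⊤ n)

sign-toggle : ∀ i (B : Subset n) → sign (toggle i B) ≡ - sign B
sign-toggle zero    (true ∷ B)  = solve 1 (λ s → s := :- (con (- 1ℚ) :* s)) refl (sign B)
sign-toggle zero    (false ∷ B) = solve 1 (λ s → con (- 1ℚ) :* s := :- s) refl (sign B)
sign-toggle (suc i) (true ∷ B)  = trans (cong (- 1ℚ *_) (sign-toggle i B))
  (solve 1 (λ s → con (- 1ℚ) :* (:- s) := :- (con (- 1ℚ) :* s)) refl (sign B))
sign-toggle (suc i) (false ∷ B) = sign-toggle i B

sign-square : (A : Subset n) → sign A * sign A ≡ 1ℚ
sign-square []          = refl
sign-square (true ∷ A)  = trans (solve 1 (λ s → con (- 1ℚ) :* s :* (con (- 1ℚ) :* s) := s :* s) refl (sign A)) (sign-square A)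
sign-square (false ∷ A) = sign-square A

ind : ∀ {p} {P : Set p} → Dec P → ℚ
ind P? = if does P? then 1ℚ else 0ℚ

ind-yes : ∀ {p} {P : Set p} (P? : Dec P) → P → ind P? ≡ 1ℚ
ind-yes (yes _) _ = refl
ind-yes (no ¬p) p = contradiction p ¬p

ind-no : ∀ {p} {P : Set p} (P? : Dec P) → ¬ P → ind P? ≡ 0ℚ
ind-no (yes p) ¬p = contradiction p ¬p
ind-no (no _)  _  = refl

module _ {p q} {P : Set p} {Q : Set q} where

  ind-cong : (P? : Dec P) (Q? : Dec Q) → (P → Q) → (Q → P) → ind P? ≡ ind Q?
  ind-cong (yes p) Q? P⇒Q Q⇒P = sym (ind-yes Q? (P⇒Q p))
  ind-cong (no ¬p) Q? P⇒Q Q⇒P = sym (ind-no Q? (¬p ∘ Q⇒P))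

  ind-× : (P? : Dec P) (Q? : Dec Q) → ind (P? ×-dec Q?) ≡ ind P? * ind Q?
  ind-× (yes _) Q? = sym (*-identityˡ (ind Q?))
  ind-× (no _)  Q? = sym (*-zeroˡ (ind Q?))

-- Matrices indexed by subsets

Kernel : ℕ → Set
Kernel n = Subset n → Subset n → ℚ

infixr 7 _·_

_·_ : Kernel n → (Subset n → ℚ) → Subset n → ℚ
(K · f) A = ∑ˢ λ B → K B A * f B

iterate : Kernel n → ℕ → (Subset n → ℚ) → Subset n → ℚ
iterate K zero    f = f
iterate K (suc t) f = K · iterate K t f

·-cong : ∀ (K : Kernel n) {f g} → (∀ B → f B ≡ g B) → ∀ A → (K · f) A ≡ (K · g) A
·-cong K f≡g A = ∑ˢ-cong (λ B → cong (K B A *_) (f≡g B))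

·-+ : ∀ (K : Kernel n) f g A → (K · (λ B → f B + g B)) A ≡ (K · f) A + (K · g) A
·-+ {n} K f g A = trans (∑ˢ-cong (λ B → *-distribˡ-+ (K B A) (f B) (g B)))
                          (∑-+ (λ B → K B A * f B) (λ B → K B A * g B) (subsets n))

·-* : ∀ (K : Kernel n) c f A → (K · (λ B → c * f B)) A ≡ c * (K · f) A
·-* {n} K c f A = trans (∑ˢ-cong (λ B → solve 3 (λ k c f → k :* (c :* f) := c :* (k :* f)) refl (K B A) c (f B)))
                    (∑-*ˡ c (λ B → K B A * f B) (subsets n))

iterate-cong : ∀ (K : Kernel n) t {f g} → (∀ B → f B ≡ g B) → ∀ A → iterate K t f A ≡ iterate K t g A
iterate-cong K zero    f≡g = f≡g
iterate-cong K (suc t) f≡g = ·-cong K (iterate-cong K t f≡g)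

-- Rational powers of unitriangular kernels

⊆∧≢⇒∣p∣<∣q∣ : {p q : Subset n} → p ⊆ q → p ≢ q → ∣ p ∣ ℕ.< ∣ q ∣
⊆∧≢⇒∣p∣<∣q∣ {p = []}          {[]}          p⊆q p≢q = contradiction refl p≢q
⊆∧≢⇒∣p∣<∣q∣ {p = inside  ∷ p} {inside  ∷ q} p⊆q p≢q = s≤s (⊆∧≢⇒∣p∣<∣q∣ (drop-∷-⊆ p⊆q) (p≢q ∘ cong (inside ∷_)))
⊆∧≢⇒∣p∣<∣q∣ {p = inside  ∷ p} {outside ∷ q} p⊆q p≢q with () ← p⊆q here
⊆∧≢⇒∣p∣<∣q∣ {p = outside ∷ p} {inside  ∷ q} p⊆q p≢q = s≤s (p⊆q⇒∣p∣≤∣q∣ (drop-∷-⊆ p⊆q))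
⊆∧≢⇒∣p∣<∣q∣ {p = outside ∷ p} {outside ∷ q} p⊆q p≢q = ⊆∧≢⇒∣p∣<∣q∣ (drop-∷-⊆ p⊆q) (p≢q ∘ cong (outside ∷_))

module UnipotentPower (K : Kernel n)
  (diagonal : ∀ A → K A A ≡ 1ℚ)
  (triangular : ∀ B A → ¬ B ⊆ A → K B A ≡ 0ℚ) where

  Δ : (Subset n → ℚ) → Subset n → ℚ
  Δ f A = (K · f) A - f A

  Δ^ : ℕ → (Subset n → ℚ) → Subset n → ℚ
  Δ^ zero    f = f
  Δ^ (suc k) f = Δ (Δ^ k f)

  Δ-linear : ∀ c f g A → Δ (λ B → c * f B + g B) A ≡ c * Δ f A + Δ g A
  Δ-linear c f g A = begin
    (K · (λ B → c * f B + g B)) A - (c * f A + g A)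
      ≡⟨ cong (_- (c * f A + g A)) (trans (·-+ K (λ B → c * f B) g A) (cong (_+ (K · g) A) (·-* K c f A))) ⟩
    c * (K · f) A + (K · g) A - (c * f A + g A)
      ≡⟨ solve 5 (λ c Kf Kg f g → c :* Kf :+ Kg :- (c :* f :+ g) := c :* (Kf :- f) :+ (Kg :- g)) refl
           c ((K · f) A) ((K · g) A) (f A) (g A) ⟩
    c * Δ f A + Δ g A ∎

  -- The diagonal term cancels, so `Δ f A` sees only proper subsets of `A`, which are smaller. Each
  -- application of `Δ` thus raises by one the size below which the function vanishes; this is the
  -- nilpotency of `Δ`.
  Δ-lowers : ∀ k f → (∀ A → ∣ A ∣ ℕ.< k → f A ≡ 0ℚ) → ∀ A → ∣ A ∣ ℕ.< suc k → Δ f A ≡ 0ℚ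
  Δ-lowers k f f≡0 A (s≤s ∣A∣≤k) = begin
    (K · f) A - f A      ≡⟨ cong (_- f A) (∑ˢ-point _ A off-diagonal) ⟩
    K A A * f A - f A    ≡⟨ cong (λ z → z * f A - f A) (diagonal A) ⟩
    1ℚ * f A - f A       ≡⟨ solve 1 (λ f → con 1ℚ :* f :- f := con 0ℚ) refl (f A) ⟩
    0ℚ                   ∎
    where
    off-diagonal : ∀ B → B ≢ A → K B A * f B ≡ 0ℚ
    off-diagonal B B≢A with B ⊆? A
    ... | yes B⊆A = trans (cong (K B A *_) (f≡0 B (ℕ.<-≤-trans (⊆∧≢⇒∣p∣<∣q∣ B⊆A B≢A) ∣A∣≤k))) (*-zeroʳ (K B A))
    ... | no  B⊈A = trans (cong (_* f B) (triangular B A B⊈A)) (*-zeroˡ (f B))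

  Δ^-vanishes : ∀ k f A → ∣ A ∣ ℕ.< k → Δ^ k f A ≡ 0ℚ
  Δ^-vanishes (suc k) f = Δ-lowers k (Δ^ k f) (Δ^-vanishes k f)

  newton : ℕ → ℚ → (Subset n → ℚ) → Subset n → ℚ
  newton m t f A = ∑ (downFrom m) λ k → binom t k * Δ^ k f A

  -- Pascal's rule term by term: the part with the lower coefficient is `Δ` of the preceding term.
  -- This shift of degree is why the second truncation is one shorter than the first.
  newton-+1 : ∀ m t f A → newton (suc m) (t + 1ℚ) f A ≡ newton (suc m) t f A + Δ (newton m t f) A
  newton-+1 zero    t f A = sym (begin
    newton 1 t f A + Δ (λ _ → 0ℚ) A          ≡⟨ cong (λ z → newton 1 t f A + (z - 0ℚ)) (∑ˢ-zero λ B → *-zeroʳ (K B A)) ⟩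
    newton 1 t f A + 0ℚ                      ≡⟨ +-identityʳ _ ⟩
    newton 1 t f A                           ∎)
  newton-+1 (suc m) t f A = begin
    binom (t + 1ℚ) (suc m) * Δ^ (suc m) f A + newton (suc m) (t + 1ℚ) f A
      ≡⟨ cong₂ (λ u v → u * Δ^ (suc m) f A + v) (binom-pascal t m) (newton-+1 m t f A) ⟩
    (b′ + b) * d + (P + Q)
      ≡⟨ solve 5 (λ b′ b d P Q → (b′ :+ b) :* d :+ (P :+ Q) := (b′ :* d :+ P) :+ (b :* d :+ Q)) refl b′ b d P Q ⟩
    newton (suc (suc m)) t f A + (b * Δ (Δ^ m f) A + Δ (newton m t f) A)
      ≡⟨ cong (newton (suc (suc m)) t f A +_) (Δ-linear b (Δ^ m f) (newton m t f) A) ⟨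
    newton (suc (suc m)) t f A + Δ (newton (suc m) t f) A ∎
    where
    b′ = binom t (suc m)
    b = binom t m
    d = Δ^ (suc m) f A
    P = newton (suc m) t f A
    Q = Δ (newton m t f) A

  -- K = 1 + Δ with Δ nilpotent, so Newton's series for (1 + Δ)ᵗ is finite.
  power : ℚ → (Subset n → ℚ) → Subset n → ℚ
  power = newton (suc n)

  power-+1 : ∀ t f A → power (t + 1ℚ) f A ≡ (K · power t f) A
  power-+1 t f A = begin
    power (t + 1ℚ) f A                             ≡⟨ newton-+1 n t f A ⟩
    -- The 0 stands for the term of degree n + 1, which vanishes because |A| ≤ n; adding it
    -- completes `newton n` to `power` under `Δ`.
    power t f A + Δ (newton n t f) A               ≡⟨ cong (power t f A +_) (+-identityˡ _) ⟨
    power t f A + (0ℚ + Δ (newton n t f) A)        ≡⟨ cong (λ z → power t f A + (z + Δ (newton n t f) A))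
                                                        (trans (cong (binom t n *_) (Δ^-vanishes (suc n) f A (s≤s (∣p∣≤n A)))) (*-zeroʳ (binom t n))) ⟨
    power t f A + (binom t n * Δ^ (suc n) f A + Δ (newton n t f) A)
                                                   ≡⟨ cong (power t f A +_) (Δ-linear (binom t n) (Δ^ n f) (newton n t f) A) ⟨
    power t f A + ((K · power t f) A - power t f A) ≡⟨ solve 2 (λ p q → p :+ (q :- p) := q) refl (power t f A) _ ⟩
    (K · power t f) A                              ∎

  power-0 : ∀ f A → power 0ℚ f A ≡ f A
  power-0 f A = go n
    where
    go : ∀ m → newton (suc m) 0ℚ f A ≡ f A
    go zero    = solve 1 (λ f → con 1ℚ :* f :+ con 0ℚ := f) refl (f A)
    go (suc m) = begin
      binom 0ℚ (suc m) * Δ^ (suc m) f A + newton (suc m) 0ℚ f A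
        ≡⟨ cong₂ (λ u v → u * Δ^ (suc m) f A + v) (binom-0 m) (go m) ⟩
      0ℚ * Δ^ (suc m) f A + f A
        ≡⟨ cong (_+ f A) (*-zeroˡ (Δ^ (suc m) f A)) ⟩
      0ℚ + f A
        ≡⟨ +-identityˡ (f A) ⟩
      f A ∎

  power-fromℕ : ∀ t f A → power (fromℕ t) f A ≡ iterate K t f A
  power-fromℕ zero    f A = power-0 f A
  power-fromℕ (suc t) f A = begin
    power (fromℕ (suc t)) f A  ≡⟨ cong (λ z → power z f A) (trans (fromℕ-homo-+ 1 t) (+-comm 1ℚ (fromℕ t))) ⟩
    power (fromℕ t + 1ℚ) f A   ≡⟨ power-+1 (fromℕ t) f A ⟩
    (K · power (fromℕ t) f) A  ≡⟨ ·-cong K (power-fromℕ t f) A ⟩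
    iterate K (suc t) f A      ∎

  -- K · power (- (t + 1)) f = power (- t) f, so a left inverse L of K satisfies L^t = power (- t).
  power-neg : ∀ L → (∀ f A → (L · (K · f)) A ≡ f A) →
              ∀ t f A → power (- fromℕ t) f A ≡ iterate L t f A
  power-neg L inverse zero    f A = power-0 f A
  power-neg L inverse (suc t) f A = begin
    power -t-1 f A               ≡⟨ inverse (power -t-1 f) A ⟨
    (L · (K · power -t-1 f)) A   ≡⟨ ·-cong L (λ B → trans (sym (power-+1 -t-1 f B)) (trans (cong (λ z → power z f B) -t-1+1) (power-neg L inverse t f B))) A ⟩
    iterate L (suc t) f A        ∎
    where
    -t-1 = - fromℕ (suc t)
    -t-1+1 : -t-1 + 1ℚ ≡ - fromℕ t
    -t-1+1 = trans (cong (λ z → - z + 1ℚ) (fromℕ-homo-+ 1 t))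
                   (solve 1 (λ t → :- (con 1ℚ :+ t) :+ con 1ℚ := :- t) refl (fromℕ t))

  Δ^ᵖ : ∀ k {F : Subset n → ℚ → ℚ → ℚ} → (∀ A → IsPolynomial (F A)) →
        ∀ A → IsPolynomial (λ x y → Δ^ k (λ B → F B x y) A)
  Δ^ᵖ zero    p A = p A
  Δ^ᵖ (suc k) p A = ∑ᵖ (subsets n) (λ B → constᵖ (K B A) *ᵖ Δ^ᵖ k p B) -ᵖ Δ^ᵖ k p A

  -- The function acted on may vary with x and y as well, since the outer power of `twoStage` acts
  -- on an inner power whose exponent is itself a polynomial.
  powerᵖ : ∀ {T F} → IsPolynomial T → (∀ A → IsPolynomial (F A)) →
           ∀ A → IsPolynomial (λ x y → power (T x y) (λ B → F B x y) A)
  powerᵖ {F = F} t p A = ∑ᵖ (downFrom (suc n)) (λ k → binomᵖ t k *ᵖ Δ^ᵖ k {F} p A)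

-- Labellings as chains of subsets

side : ℕ → Bool → ℕ → List ℕ
side x inside? e = if inside? then downFrom x else e ∷ []

-- Elements off A already carry their label e; those in A still choose one below x.
box : ℕ → Subset n → Vec ℕ n → List (Vec ℕ n)
box x A e = ∏ (zipWith (side x) A e)

-- Freezes the label x on `A`. In a box over B ⊆ A the elements of `B` choose again, so exactly A ∖
-- B retains x.
fill : ℕ → Subset n → Vec ℕ n → Vec ℕ n
fill x = zipWith (λ inside? e → if inside? then x else e)

box-inside : ∀ {x} (A : Subset n) e {v i} → v List.∈ box x A e → i ∈ A → lookup v i ℕ.< x
box-inside {x = x} (true ∷ A) (e₀ ∷ e) v∈ here
  with _ , _ , i∈ , _ , refl ← ∈-cartesianProductWith⁻ _∷_ (downFrom x) (box x A e) v∈ = ∈-downFrom⁻ i∈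
box-inside {x = x} (a ∷ A) (e₀ ∷ e) v∈ (there i∈A)
  with _ , _ , _ , v∈′ , refl ← ∈-cartesianProductWith⁻ _∷_ (side x a e₀) (box x A e) v∈ = box-inside A e v∈′ i∈A

box-outside : ∀ {x} (A : Subset n) e {v} i → v List.∈ box x A e → i ∉ A → lookup v i ≡ lookup e i
box-outside {x = x} (true ∷ A) (e₀ ∷ e) zero v∈ 0∉A = contradiction here 0∉A
box-outside {x = x} (false ∷ A) (e₀ ∷ e) zero v∈ 0∉A
  with _ , _ , here refl , _ , refl ← ∈-cartesianProductWith⁻ _∷_ (e₀ ∷ []) (box x A e) v∈ = refl
box-outside {x = x} (a ∷ A) (e₀ ∷ e) (suc i) v∈ i∉A
  with _ , _ , _ , v∈′ , refl ← ∈-cartesianProductWith⁻ _∷_ (side x a e₀) (box x A e) v∈ = box-outside A e i v∈′ (i∉A ∘ there)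

lookup-fill : ∀ x (A : Subset n) e {i} → i ∈ A → lookup (fill x A e) i ≡ x
lookup-fill x (true ∷ A) (_ ∷ e) here        = refl
lookup-fill x (_ ∷ A)    (_ ∷ e) (there i∈A) = lookup-fill x A e i∈A

-- Sort the labellings by the set `B` of elements of `A` whose label is below x; the rest of `A` has
-- label exactly x.
∑-box-suc : ∀ x (A : Subset n) e (f : Vec ℕ n → ℚ) →
  ∑ (box (suc x) A e) f ≡ ∑ˢ λ B → ind (B ⊆? A) * ∑ (box x B (fill x A e)) f
∑-box-suc x [] [] f = solve 1 (λ f → f :+ con 0ℚ := con 1ℚ :* (f :+ con 0ℚ) :+ con 0ℚ) refl (f [])
∑-box-suc {suc n} x (true ∷ A) (e₀ ∷ e) f = begin
  ∑ (box (suc x) (true ∷ A) (e₀ ∷ e)) f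
    ≡⟨ ∑-∏ f (downFrom (suc x)) (zipWith (side (suc x)) A e) ⟩
  g x + ∑ (downFrom x) g
    ≡⟨ +-comm (g x) _ ⟩
  ∑ (downFrom x) g + g x
    ≡⟨ cong₂ _+_ below top ⟩
  ∑ˢ (h ∘ (true ∷_)) + ∑ˢ (h ∘ (false ∷_))
    ≡⟨ ∑ˢ-suc h ⟨
  ∑ˢ h ∎
  where
  u = fill x A e
  g = λ i → ∑ (box (suc x) A e) (f ∘ (i ∷_))
  h : Subset (suc n) → ℚ
  h B = ind (B ⊆? true ∷ A) * ∑ (box x B (x ∷ u)) f
  below : ∑ (downFrom x) g ≡ ∑ˢ (h ∘ (true ∷_))
  below = begin
    ∑ (downFrom x) g
      ≡⟨ ∑-cong (downFrom x) (λ {i} _ → ∑-box-suc x A e (f ∘ (i ∷_))) ⟩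
    ∑ (downFrom x) (λ i → ∑ˢ λ B → ind (B ⊆? A) * ∑ (box x B u) (f ∘ (i ∷_)))
      ≡⟨ ∑-swap (λ i B → ind (B ⊆? A) * ∑ (box x B u) (f ∘ (i ∷_))) (downFrom x) (subsets n) ⟩
    ∑ˢ (λ B → ∑ (downFrom x) λ i → ind (B ⊆? A) * ∑ (box x B u) (f ∘ (i ∷_)))
      ≡⟨ ∑ˢ-cong (λ B → trans (∑-*ˡ (ind (B ⊆? A)) (λ i → ∑ (box x B u) (f ∘ (i ∷_))) (downFrom x))
                              (cong (ind (B ⊆? A) *_) (sym (∑-∏ f (downFrom x) (zipWith (side x) B u))))) ⟩
    ∑ˢ (h ∘ (true ∷_)) ∎
  top : g x ≡ ∑ˢ (h ∘ (false ∷_))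
  top = trans (∑-box-suc x A e (f ∘ (x ∷_)))
    (∑ˢ-cong λ B → cong (ind (B ⊆? A) *_) (sym (trans (∑-∏ f (x ∷ []) (zipWith (side x) B u)) (+-identityʳ _))))
∑-box-suc {suc n} x (false ∷ A) (e₀ ∷ e) f = begin
  ∑ (box (suc x) (false ∷ A) (e₀ ∷ e)) f
    ≡⟨ ∑-∏ f (e₀ ∷ []) (zipWith (side (suc x)) A e) ⟩
  ∑ (box (suc x) A e) (f ∘ (e₀ ∷_)) + 0ℚ
    ≡⟨ +-comm (∑ (box (suc x) A e) (f ∘ (e₀ ∷_))) 0ℚ ⟩
  0ℚ + ∑ (box (suc x) A e) (f ∘ (e₀ ∷_))
    ≡⟨ cong₂ _+_ (sym (∑ˢ-zero λ B → *-zeroˡ (∑ (box x (true ∷ B) (e₀ ∷ u)) f))) below ⟩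
  ∑ˢ (h ∘ (true ∷_)) + ∑ˢ (h ∘ (false ∷_))
    ≡⟨ ∑ˢ-suc h ⟨
  ∑ˢ h ∎
  where
  u = fill x A e
  h : Subset (suc n) → ℚ
  h B = ind (B ⊆? false ∷ A) * ∑ (box x B (e₀ ∷ u)) f
  below : ∑ (box (suc x) A e) (f ∘ (e₀ ∷_)) ≡ ∑ˢ (h ∘ (false ∷_))
  below = trans (∑-box-suc x A e (f ∘ (e₀ ∷_)))
    (∑ˢ-cong λ B → cong (ind (B ⊆? A) *_) (sym (trans (∑-∏ f (e₀ ∷ []) (zipWith (side x) B u)) (+-identityʳ _))))

δ : Subset n → ℚ
δ []          = 1ℚ
δ (true ∷ A)  = 0ℚ
δ (false ∷ A) = δ A

∑-box-zero : ∀ (A : Subset n) e → ∑ (box 0 A e) (λ _ → 1ℚ) ≡ δ A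
∑-box-zero []          []       = refl
∑-box-zero (true ∷ A)  (_ ∷ e)  = refl
∑-box-zero (false ∷ A) (e₀ ∷ e) = trans (∑-∏ (λ _ → 1ℚ) (e₀ ∷ []) (zipWith (side 0) A e))
                                        (trans (+-identityʳ _) (∑-box-zero A e))

sign-δ : ∀ (A : Subset n) → sign A * δ A ≡ δ A
sign-δ []          = refl
sign-δ (true ∷ A)  = *-zeroʳ (- 1ℚ * sign A)
sign-δ (false ∷ A) = sign-δ A

-- From counts over Fin to sums over boxes

fromℕ-count : ∀ {p} {P : A → Set p} (P? : ∀ a → Dec (P a)) {N} (f : Fin N → A) →
  fromℕ (count P? (tabulate f)) ≡ sum (λ i → ind (P? (f i)))
fromℕ-count P? {zero}  f = refl
fromℕ-count P? {suc N} f with P? (f zero)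
... | yes _ = trans (fromℕ-homo-+ 1 (count P? (tabulate (f ∘ suc)))) (cong (1ℚ +_) (fromℕ-count P? (f ∘ suc)))
... | no  _ = trans (fromℕ-count P? (f ∘ suc)) (sym (+-identityˡ _))

sum-↑ : ∀ m k (f : Fin (m ℕ.+ k) → ℚ) →
  sum f ≡ sum (λ i → f (i Fin.↑ˡ k)) + sum (λ j → f (m Fin.↑ʳ j))
sum-↑ zero    k f = sym (+-identityˡ (sum f))
sum-↑ (suc m) k f = trans (cong (f zero +_) (sum-↑ m k (f ∘ suc))) (sym (+-assoc (f zero) _ _))

sum-combine : ∀ m k (f : Fin (m ℕ.* k) → ℚ) → sum f ≡ sum (λ i → sum (λ j → f (combine {m} {k} i j)))
sum-combine zero    k f = refl
sum-combine (suc m) k f = trans (sum-↑ k (m ℕ.* k) f)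
  (cong (sum (λ j → f (j Fin.↑ˡ (m ℕ.* k))) +_) (sum-combine m k (λ i → f (k Fin.↑ʳ i))))

-- The two enumerations run in opposite directions; `shift` carries the term at 0 to the far end.
sum-downFrom : ∀ x (f : ℕ → ℚ) → sum {x} (f ∘ toℕ) ≡ ∑ (downFrom x) f
sum-downFrom zero    f = refl
sum-downFrom (suc x) f = trans (cong (f 0 +_) (sum-downFrom x (f ∘ suc))) (shift x)
  where
  shift : ∀ x → f 0 + ∑ (downFrom x) (f ∘ suc) ≡ ∑ (downFrom (suc x)) f
  shift zero    = refl
  shift (suc x) = begin
    f 0 + (f (suc x) + ∑ (downFrom x) (f ∘ suc))   ≡⟨ solve 3 (λ a b c → a :+ (b :+ c) := b :+ (a :+ c)) refl (f 0) (f (suc x)) _ ⟩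
    f (suc x) + (f 0 + ∑ (downFrom x) (f ∘ suc))   ≡⟨ cong (f (suc x) +_) (shift x) ⟩
    f (suc x) + ∑ (downFrom (suc x)) f             ∎

labels : ∀ {x} → (Fin n → Fin x) → Vec ℕ n
labels φ = tabulate (toℕ ∘ φ)

-- `finToFun` reads its index in base x with the value at `zero` as leading digit; `combine` splits
-- off this digit, which matches the outermost factor of the box.
sum-finToFun : ∀ n x (f : Vec ℕ n → ℚ) e →
  sum {x ℕ.^ n} (λ i → f (labels (finToFun {x} {n} i))) ≡ ∑ (box x ⊤ e) f
sum-finToFun zero    x f []      = refl
sum-finToFun (suc n) x f (e₀ ∷ e) = begin
  sum {x ℕ.* x ℕ.^ n} (λ i → f (labels (finToFun {x} {suc n} i)))
    ≡⟨ sum-combine x (x ℕ.^ n) _ ⟩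
  sum {x} (λ i → sum {x ℕ.^ n} λ j → f (labels (finToFun {x} {suc n} (combine i j))))
    ≡⟨ sum-cong-≗ {x} (λ i → sum-cong-≗ {x ℕ.^ n} λ j → cong f (cong₂ _∷_
         (cong (toℕ ∘ proj₁) (remQuot-combine {x} i j))
         (tabulate-cong λ a → cong (λ q → toℕ (finToFun {x} {n} (proj₂ q) a)) (remQuot-combine {x} i j)))) ⟩
  sum {x} (λ i → sum {x ℕ.^ n} λ j → f (toℕ i ∷ labels (finToFun {x} {n} j)))
    ≡⟨ sum-cong-≗ {x} (λ i → sum-finToFun n x (f ∘ (toℕ i ∷_)) e) ⟩
  sum {x} (λ i → ∑ (box x ⊤ e) (f ∘ (toℕ i ∷_)))
    ≡⟨ sum-downFrom x _ ⟩
  ∑ (downFrom x) (λ i → ∑ (box x ⊤ e) (f ∘ (i ∷_)))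
    ≡⟨ ∑-∏ f (downFrom x) (zipWith (side x) ⊤ e) ⟨
  ∑ (box x ⊤ (e₀ ∷ e)) f ∎

-- Q is _≤_ or _<_; only Q 0 0 distinguishes the two.
module Labelling {ℓ} {R : Rel (Fin n) ℓ} (R? : Decidable R) {Q : Rel ℕ 0ℓ} (Q? : Decidable Q)
  (<⇒Q : ∀ {i j} → i ℕ.< j → Q i j)
  (>⇒¬Q : ∀ {i j} → j ℕ.< i → ¬ Q i j)
  (Q-diagonal⁻ : ∀ {i} → Q i i → Q 0 0)
  (Q-diagonal⁺ : ∀ {i} → Q 0 0 → Q i i)
  (C : Subset n) where

  Monotone : Subset n → Vec ℕ n → Set ℓ
  Monotone A v = ∀ a b → a ∈ A → b ∈ A → R a b → Q (lookup v a) (lookup v b)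

  Bounded : ℕ → Subset n → Vec ℕ n → Set
  Bounded y A v = ∀ c → c ∈ A → c ∈ C → y ℕ.≤ lookup v c

  Valid : ℕ → Subset n → Vec ℕ n → Set ℓ
  Valid y A v = Monotone A v × Bounded y A v

  valid? : ∀ y A v → Dec (Valid y A v)
  valid? y A v =
    all? (λ a → all? λ b → (a ∈? A) →-dec ((b ∈? A) →-dec (R? a b →-dec Q? (lookup v a) (lookup v b))))
    ×-dec all? (λ c → (c ∈? A) →-dec ((c ∈? C) →-dec (y ℕ.≤? lookup v c)))

  -- A ∖ B can be the set of elements with the greatest label.
  Top : Subset n → Subset n → Set ℓ
  Top B A = B ⊆ A × (∀ a b → a ∈ A → a ∉ B → b ∈ A → R a b → b ∉ B × Q 0 0)

  top? : ∀ B A → Dec (Top B A)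
  top? B A = (B ⊆? A) ×-dec
    all? (λ a → all? λ b → (a ∈? A) →-dec (¬? (a ∈? B) →-dec ((b ∈? A) →-dec (R? a b →-dec (¬? (b ∈? B) ×-dec Q? 0 0)))))

  layer : Kernel n
  layer B A = ind (top? B A)

  NoCeleste : Subset n → Set
  NoCeleste A = ∀ c → c ∈ A → c ∉ C

  noCeleste? : ∀ A → Dec (NoCeleste A)
  noCeleste? A = all? λ c → (c ∈? A) →-dec ¬? (c ∈? C)

  restrict : (Subset n → ℚ) → Subset n → ℚ
  restrict f A = ind (noCeleste? A) * f A

  number : ℕ → ℕ → Subset n → Vec ℕ n → ℚ
  number y x A e = ∑ (box x A e) (λ v → ind (valid? y A v))

  number-zero : ∀ A e → number 0 0 A e ≡ δ A
  number-zero A e = trans (∑-cong (box 0 A e) λ {v} v∈ → ind-yes (valid? 0 A v)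
      ( (λ a b a∈A _ _ → contradiction (box-inside A e v∈ a∈A) λ ())
      , (λ c c∈A _ → contradiction (box-inside A e v∈ c∈A) λ ())))
    (∑-box-zero A e)

  -- With all labels below y no celeste element can reach the bound, so none may be present, and for
  -- the remaining sets the bound 0 says the same.
  number-threshold : ∀ y A e → number y y A e ≡ ind (noCeleste? A) * number 0 y A e
  number-threshold y A e = trans (∑-cong (box y A e) λ {v} v∈ → trans
      (ind-cong (valid? y A v) (noCeleste? A ×-dec valid? 0 A v)
        (λ (mono , bound) → (λ c c∈A c∈C → ℕ.<⇒≱ (box-inside A e v∈ c∈A) (bound c c∈A c∈C)) , mono , λ _ _ _ → z≤n)
        (λ (none , mono , _) → mono , λ c c∈A c∈C → contradiction c∈C (none c c∈A)))
      (ind-× (noCeleste? A) (valid? 0 A v)))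
    (∑-*ˡ (ind (noCeleste? A)) (λ v → ind (valid? 0 A v)) (box y A e))

  -- Validity on `A` is validity on `B` together with a condition on the top layer A ∖ B, whose
  -- label is x. Since y ≤ x, that layer meets the celeste bound automatically.
  number-suc : ∀ y x → y ℕ.≤ x → ∀ A e →
    number y (suc x) A e ≡ ∑ˢ λ B → layer B A * number y x B (fill x A e)
  number-suc y x y≤x A e = trans (∑-box-suc x A e _) (∑ˢ-cong λ B → begin
    ind (B ⊆? A) * ∑ (box x B u) (λ v → ind (valid? y A v))
      ≡⟨ ∑-*ˡ (ind (B ⊆? A)) (λ v → ind (valid? y A v)) (box x B u) ⟨
    ∑ (box x B u) (λ v → ind (B ⊆? A) * ind (valid? y A v))
      ≡⟨ ∑-cong (box x B u) (λ {v} v∈ → trans (sym (ind-× (B ⊆? A) (valid? y A v)))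
           (trans (ind-cong (B ⊆? A ×-dec valid? y A v) (top? B A ×-dec valid? y B v) (peel B v∈) (unpeel B v∈))
                  (ind-× (top? B A) (valid? y B v)))) ⟩
    ∑ (box x B u) (λ v → layer B A * ind (valid? y B v))
      ≡⟨ ∑-*ˡ (layer B A) (λ v → ind (valid? y B v)) (box x B u) ⟩
    layer B A * number y x B u ∎)
    where
    u = fill x A e
    module _ (B : Subset n) {v} (v∈ : v List.∈ box x B u) where

      below : ∀ {a} → a ∈ B → lookup v a ℕ.< x
      below = box-inside B u v∈

      at : ∀ {a} → a ∈ A → a ∉ B → lookup v a ≡ x
      at a∈A a∉B = trans (box-outside B u _ v∈ a∉B) (lookup-fill x A e a∈A)

      peel : B ⊆ A × Valid y A v → Top B A × Valid y B v
      peel (B⊆A , mono , bound) =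
        (B⊆A , λ a b a∈A a∉B b∈A Rab →
           -- `a` has label x and labels in `B` are below x, so `b` cannot lie in `B`; hence `b` has
           -- label x too and Q x x holds.
           let Qxb = subst (λ z → Q z (lookup v b)) (at a∈A a∉B) (mono a b a∈A b∈A Rab)
               b∉B = λ b∈B → >⇒¬Q (below b∈B) Qxb
           in b∉B , Q-diagonal⁻ (subst (Q x) (at b∈A b∉B) Qxb)) ,
        (λ a b a∈B b∈B → mono a b (B⊆A a∈B) (B⊆A b∈B)) ,
        (λ c c∈B → bound c (B⊆A c∈B))

      unpeel : Top B A × Valid y B v → B ⊆ A × Valid y A v
      unpeel ((B⊆A , top) , mono , bound) = B⊆A , mono′ , bound′
        where
        mono′ : Monotone A v
        mono′ a b a∈A b∈A Rab with a ∈? B | b ∈? B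
        ... | yes a∈B | yes b∈B = mono a b a∈B b∈B Rab
        ... | yes a∈B | no  b∉B = <⇒Q (subst (lookup v a ℕ.<_) (sym (at b∈A b∉B)) (below a∈B))
        ... | no  a∉B | _       =
          -- Both labels equal x, so the claim is Q x x, which comes from Q 0 0.
          let b∉B , Q00 = top a b a∈A a∉B b∈A Rab
          in subst₂ Q (sym (at a∈A a∉B)) (sym (at b∈A b∉B)) (Q-diagonal⁺ Q00)
        bound′ : Bounded y A v
        bound′ c c∈A c∈C with c ∈? B
        ... | yes c∈B = bound c c∈B c∈C
        ... | no  c∉B = subst (y ℕ.≤_) (sym (at c∈A c∉B)) y≤x

  number-iterate₀ : ∀ x A e → number 0 x A e ≡ iterate layer x δ A
  number-iterate₀ zero    A e = number-zero A e
  number-iterate₀ (suc x) A e = trans (number-suc 0 x z≤n A e)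
    (∑ˢ-cong λ B → cong (layer B A *_) (number-iterate₀ x B (fill x A e)))

  number-iterate : ∀ y t A e →
    number y (t ℕ.+ y) A e ≡ iterate layer t (restrict (iterate layer y δ)) A
  number-iterate y zero    A e = trans (number-threshold y A e)
    (cong (ind (noCeleste? A) *_) (number-iterate₀ y A e))
  number-iterate y (suc t) A e = trans (number-suc y (t ℕ.+ y) (ℕ.m≤n+m y t) A e)
    (∑ˢ-cong λ B → cong (layer B A *_) (number-iterate y t B (fill (t ℕ.+ y) A e)))

  fromℕ-number : ∀ {x y p} {D : (Fin n → Fin x) → Set p} (D? : ∀ φ → Dec (D φ)) →
    (∀ φ → D φ → (∀ a b → R a b → Q (toℕ (φ a)) (toℕ (φ b))) × (∀ c → c ∈ C → y ℕ.≤ toℕ (φ c))) →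
    (∀ φ → (∀ a b → R a b → Q (toℕ (φ a)) (toℕ (φ b))) → (∀ c → c ∈ C → y ℕ.≤ toℕ (φ c)) → D φ) →
    fromℕ (count (λ i → D? (finToFun i)) (allFin (x ℕ.^ n))) ≡ number y x ⊤ (replicate n 0)
  fromℕ-number {x} {y} D? to from = begin
    fromℕ (count (λ i → D? (finToFun i)) (allFin (x ℕ.^ n)))
      ≡⟨ fromℕ-count (λ i → D? (finToFun {x} {n} i)) id ⟩
    sum {x ℕ.^ n} (λ i → ind (D? (finToFun i)))
      ≡⟨ sum-cong-≗ {x ℕ.^ n} (λ i → indicator (finToFun i)) ⟩
    sum {x ℕ.^ n} (λ i → ind (valid? y ⊤ (labels (finToFun {x} {n} i))))
      ≡⟨ sum-finToFun n x (λ v → ind (valid? y ⊤ v)) (replicate n 0) ⟩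
    number y x ⊤ (replicate n 0) ∎
    where
    indicator : ∀ φ → ind (D? φ) ≡ ind (valid? y ⊤ (labels φ))
    indicator φ = ind-cong (D? φ) (valid? y ⊤ (labels φ))
      (λ Dφ → let mono , bound = to φ Dφ in
        (λ a b _ _ Rab → subst₂ Q (eq a) (eq b) (mono a b Rab)) ,
        (λ c _ c∈C → subst (y ℕ.≤_) (eq c) (bound c c∈C)))
      (λ (mono , bound) → from φ
        (λ a b Rab → subst₂ Q (sym (eq a)) (sym (eq b)) (mono a b ∈⊤ ∈⊤ Rab))
        (λ c c∈C → subst (y ℕ.≤_) (sym (eq c)) (bound c ∈⊤ c∈C)))
      where
      eq : ∀ a → toℕ (φ a) ≡ lookup (labels φ) a
      eq a = sym (lookup∘tabulate (toℕ ∘ φ) a)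

-- Reciprocity

module _ {n ℓ} (P : BicoloredPoset n ℓ) where
  open BicoloredPoset P
  open IsDecPartialOrder isDecPartialOrder using () renaming (isPartialOrder to ≼-isPartialOrder)

  module Weak = Labelling _≼?_ ℕ._≤?_ ℕ.<⇒≤ ℕ.<⇒≱ (λ _ → z≤n) (λ _ → ℕ.≤-refl) celeste
  module Strict = Labelling _≺?_ ℕ._<?_ id ℕ.<-asym (λ i<i → contradiction i<i (ℕ.<-irrefl refl)) (λ ()) celeste

  -- The inverse of Z by cancellation

  MaximalIn : Subset n → Fin n → Set ℓ
  MaximalIn A i = ∀ b → b ∈ A → ¬ i ≺ b

  -- The sets `B` that contribute to the entry of σ Z° σ Z at (E, A).
  Between : (E A B : Subset n) → Set ℓ
  Between E A B = Strict.Top B A × Weak.Top E B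

  between? : ∀ E A B → Dec (Between E A B)
  between? E A B = Strict.top? B A ×-dec Weak.top? E B

  module _ {E A : Subset n} where

    between-⊆ : ∀ {B} → Between E A B → E ⊆ A
    between-⊆ ((B⊆A , _) , (E⊆B , _)) = B⊆A ∘ E⊆B

    between-maximal : ∀ {B a} → Between E A B → a ∈ A → a ∉ B → MaximalIn A a
    between-maximal ((_ , top) , _) a∈A a∉B b b∈A a≺b with () ← proj₂ (top _ b a∈A a∉B b∈A a≺b)

    -- An `a` in B ∖ E would force `b` out of `E` by the up-set condition; an `a` outside `B` is
    -- maximal in `A` and cannot lie strictly below `b`.
    between-downset : ∀ {B a b} → Between E A B → a ∈ A → b ∈ E → a ≼ b → a ∈ E
    between-downset {B} {a} {b} btw@(_ , (E⊆B , top)) a∈A b∈E a≼b with a ∈? E | a ∈? B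
    ... | yes a∈E | _       = a∈E
    ... | no  a∉E | yes a∈B = contradiction b∈E (proj₁ (top a b a∈B a∉E (E⊆B b∈E) a≼b))
    ... | no  a∉E | no  a∉B = contradiction (a≼b , λ { refl → a∉E b∈E })
                                            (between-maximal btw a∈A a∉B b (between-⊆ btw b∈E))

    -- The strict condition asks only that the elements of `A` missing from the set be maximal in
    -- `A`, and `i` is. The weak one survives because `E` is a down-set of all of `A`, hence of any
    -- subset containing it.
    between-toggle : ∀ {i} → i ∈ A → i ∉ E → MaximalIn A i → ∀ {B} → Between E A B → Between E A (toggle i B)
    between-toggle {i} i∈A i∉E maximal {B} btw@((B⊆A , topS) , (E⊆B , topW)) =
      (B′⊆A , λ a b a∈A a∉B′ b∈A a≺b → contradiction a≺b (maximal′ a∈A a∉B′ b b∈A)) ,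
      (λ e∈E → ∈-toggle⁺ B (λ { refl → i∉E e∈E }) (E⊆B e∈E)) ,
      (λ a b a∈B′ a∉E b∈B′ a≼b → (λ b∈E → a∉E (between-downset btw (B′⊆A a∈B′) b∈E a≼b)) , z≤n)
      where
      B′⊆A : toggle i B ⊆ A
      B′⊆A {j} j∈ with j Fin.≟ i
      ... | yes refl = i∈A
      ... | no  j≢i  = B⊆A (∈-toggle⁻ B j≢i j∈)
      maximal′ : ∀ {a} → a ∈ A → a ∉ toggle i B → MaximalIn A a
      maximal′ {a} a∈A a∉ with a Fin.≟ i
      ... | yes refl = maximal
      ... | no  a≢i  = between-maximal btw a∈A (a∉ ∘ ∈-toggle⁺ B a≢i)

    -- Induction from the top: if everything in `A` above `a` lies in `E`, then either `a` is below
    -- such an element and the down-set `E` contains it, or `a` is maximal, which `none` excludes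
    -- outside `E`.
    between-equal : (∀ i → i ∈ A → i ∉ E → ¬ MaximalIn A i) → ∀ {B} → Between E A B → E ≡ A
    between-equal none btw = ⊆-antisym (between-⊆ btw) (λ {a} → A⊆E a (po-noetherian ≼-isPartialOrder a))
      where
      A⊆E : ∀ a → Acc _ a → a ∈ A → a ∈ E
      A⊆E a (acc above) a∈A with a ∈? E
      ... | yes a∈E = a∈E
      ... | no  a∉E = contradiction
        (λ b b∈A a≺b → a∉E (between-downset btw a∈A (A⊆E b (above a≺b) b∈A) (proj₁ a≺b)))
        (none a a∈A a∉E)

  between-refl : ∀ A → Between A A A
  between-refl A = (id , λ a b a∈A a∉A → contradiction a∈A a∉A) , (id , λ a b a∈A a∉A → contradiction a∈A a∉A)

  term : (E A B : Subset n) → ℚ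
  term E A B = sign A * sign B * ind (between? E A B)

  ∑-term-diagonal : ∀ A → ∑ˢ (term A A) ≡ 1ℚ
  ∑-term-diagonal A = begin
    ∑ˢ (term A A)             ≡⟨ ∑ˢ-point (term A A) A (λ B B≢A → trans (cong (sign A * sign B *_)
                                   (ind-no (between? A A B) λ { ((B⊆A , _) , (A⊆B , _)) → B≢A (⊆-antisym B⊆A A⊆B) }))
                                   (*-zeroʳ (sign A * sign B))) ⟩
    sign A * sign A * ind (between? A A A)
                              ≡⟨ cong₂ _*_ (sign-square A) (ind-yes (between? A A A) (between-refl A)) ⟩
    1ℚ                        ∎

  -- Toggling a maximal element of `A` outside `E` cancels the terms in pairs; without such an
  -- element every term is already 0.
  ∑-term-off-diagonal : ∀ E A → E ≢ A → ∑ˢ (term E A) ≡ 0ℚ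
  ∑-term-off-diagonal E A E≢A
    with any? (λ i → (i ∈? A) ×-dec (¬? (i ∈? E) ×-dec all? λ b → (b ∈? A) →-dec ¬? (i ≺? b)))
  ... | yes (i , i∈A , i∉E , maximal) = ∑ˢ-toggle (term E A) i cancel
    where
    cancel : ∀ B → term E A B + term E A (toggle i B) ≡ 0ℚ
    cancel B = begin
      s * t * c + s * sign (toggle i B) * ind (between? E A (toggle i B))
        ≡⟨ cong₂ (λ u v → s * t * c + s * u * v) (sign-toggle i B)
             (ind-cong (between? E A (toggle i B)) (between? E A B)
               (subst (Between E A) (toggle-involutive i B) ∘ between-toggle i∈A i∉E maximal)
               (between-toggle i∈A i∉E maximal)) ⟩
      s * t * c + s * - t * c
        ≡⟨ solve 3 (λ s t c → s :* t :* c :+ s :* (:- t) :* c := con 0ℚ) refl s t c ⟩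
      0ℚ ∎
      where
      s = sign A
      t = sign B
      c = ind (between? E A B)
  ... | no none = ∑ˢ-zero λ B → trans (cong (sign A * sign B *_)
      (ind-no (between? E A B) (E≢A ∘ between-equal (λ i i∈A i∉E maximal → none (i , i∈A , i∉E , maximal)))))
    (*-zeroʳ (sign A * sign B))

  signedStrict : Kernel n
  signedStrict B A = sign A * Strict.layer B A * sign B

  signedStrict-inverse : ∀ f A → (signedStrict · (Weak.layer · f)) A ≡ f A
  signedStrict-inverse f A = begin
    ∑ˢ (λ B → signedStrict B A * ∑ˢ λ E → Weak.layer E B * f E)
      ≡⟨ ∑ˢ-cong (λ B → ∑-*ˡ (signedStrict B A) (λ E → Weak.layer E B * f E) (subsets n)) ⟨
    ∑ˢ (λ B → ∑ˢ λ E → signedStrict B A * (Weak.layer E B * f E))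
      ≡⟨ ∑-swap (λ B E → signedStrict B A * (Weak.layer E B * f E)) (subsets n) (subsets n) ⟩
    ∑ˢ (λ E → ∑ˢ λ B → signedStrict B A * (Weak.layer E B * f E))
      ≡⟨ ∑ˢ-cong (λ E → trans (∑ˢ-cong (λ B → regroup E B)) (∑-*ˡ (f E) (term E A) (subsets n))) ⟩
    ∑ˢ (λ E → f E * ∑ˢ (term E A))
      ≡⟨ ∑ˢ-point (λ E → f E * ∑ˢ (term E A)) A
           (λ E E≢A → trans (cong (f E *_) (∑-term-off-diagonal E A E≢A)) (*-zeroʳ (f E))) ⟩
    f A * ∑ˢ (term A A)
      ≡⟨ cong (f A *_) (∑-term-diagonal A) ⟩
    f A * 1ℚ
      ≡⟨ *-identityʳ (f A) ⟩
    f A ∎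
    where
    regroup : ∀ E B → signedStrict B A * (Weak.layer E B * f E) ≡ f E * term E A B
    regroup E B = trans
      (solve 5 (λ s l t w f → s :* l :* t :* (w :* f) := f :* (s :* t :* (l :* w))) refl
        (sign A) (Strict.layer B A) (sign B) (Weak.layer E B) (f E))
      (cong (λ z → f E * (sign A * sign B * z)) (sym (ind-× (Strict.top? B A) (Weak.top? E B))))

  -- (σ Z° σ)ᵗ telescopes to σ Z°ᵗ σ because σ² = 1.
  iterate-signedStrict : ∀ t f A →
    iterate signedStrict t f A ≡ sign A * iterate Strict.layer t (λ B → sign B * f B) A
  iterate-signedStrict zero    f A = begin
    f A                       ≡⟨ *-identityˡ (f A) ⟨
    1ℚ * f A                  ≡⟨ cong (_* f A) (sign-square A) ⟨
    sign A * sign A * f A     ≡⟨ *-assoc (sign A) (sign A) (f A) ⟩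
    sign A * (sign A * f A)   ∎
  iterate-signedStrict (suc t) f A = begin
    ∑ˢ (λ B → signedStrict B A * iterate signedStrict t f B)
      ≡⟨ ∑ˢ-cong (λ B → trans (cong (signedStrict B A *_) (iterate-signedStrict t f B)) (regroup B)) ⟩
    ∑ˢ (λ B → sign A * (Strict.layer B A * g B))
      ≡⟨ ∑-*ˡ (sign A) (λ B → Strict.layer B A * g B) (subsets n) ⟩
    sign A * (Strict.layer · g) A ∎
    where
    g = iterate Strict.layer t (λ B → sign B * f B)
    regroup : ∀ B → signedStrict B A * (sign B * g B) ≡ sign A * (Strict.layer B A * g B)
    regroup B = begin
      sign A * Strict.layer B A * sign B * (sign B * g B)
        ≡⟨ solve 4 (λ s l t g → s :* l :* t :* (t :* g) := s :* (l :* (t :* t :* g))) refl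
             (sign A) (Strict.layer B A) (sign B) (g B) ⟩
      sign A * (Strict.layer B A * (sign B * sign B * g B))
        ≡⟨ cong (λ z → sign A * (Strict.layer B A * (z * g B))) (sign-square B) ⟩
      sign A * (Strict.layer B A * (1ℚ * g B))
        ≡⟨ cong (λ z → sign A * (Strict.layer B A * z)) (*-identityˡ (g B)) ⟩
      sign A * (Strict.layer B A * g B) ∎

  open UnipotentPower Weak.layer
    (λ A → ind-yes (Weak.top? A A) (proj₂ (between-refl A)))
    (λ B A B⊈A → ind-no (Weak.top? B A) (λ top → B⊈A (proj₁ top)))

  -- In labels counted from 0, the weak bound with y + 1 and the strict bound with y both read y ≤
  -- `toℕ`. This is the origin of the shift y + 1 in the reciprocity.
  fromℕ-Ω : ∀ x y → fromℕ (Ω P x (suc y)) ≡ Weak.number y x ⊤ (replicate n 0)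
  fromℕ-Ω x y = Weak.fromℕ-number (orderPreserving? P x (suc y))
    (λ φ (mono , bound) → (λ a b a≼b → ℕ.s≤s⁻¹ (mono a b a≼b)) , (λ c c∈C → ℕ.s≤s⁻¹ (bound c c∈C)))
    (λ φ mono bound → (λ a b a≼b → s≤s (mono a b a≼b)) , (λ c c∈C → s≤s (bound c c∈C)))

  fromℕ-Ω° : ∀ x y → fromℕ (Ω° P x y) ≡ Strict.number y x ⊤ (replicate n 0)
  fromℕ-Ω° x y = Strict.fromℕ-number (strictlyOrderPreserving? P x y)
    (λ φ (mono , bound) → (λ a b a≺b → ℕ.s≤s⁻¹ (mono a b a≺b)) , (λ c c∈C → ℕ.s≤s⁻¹ (bound c c∈C)))
    (λ φ mono bound → (λ a b a≺b → s≤s (mono a b a≺b)) , (λ c c∈C → s≤s (bound c c∈C)))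

  -- The elements labelled at most s form a down-set free of celeste elements;
  -- t counts the remaining labels.
  twoStage : ℚ → ℚ → ℚ
  twoStage t s = power t (Weak.restrict (power s δ)) ⊤

  twoStage-Ω : ∀ t y → twoStage (fromℕ t) (fromℕ y) ≡ fromℕ (Ω P (t ℕ.+ y) (suc y))
  twoStage-Ω t y = begin
    power (fromℕ t) (Weak.restrict (power (fromℕ y) δ)) ⊤
      ≡⟨ power-fromℕ t (Weak.restrict (power (fromℕ y) δ)) ⊤ ⟩
    iterate Weak.layer t (Weak.restrict (power (fromℕ y) δ)) ⊤
      ≡⟨ iterate-cong Weak.layer t (λ B → cong (ind (Weak.noCeleste? B) *_) (power-fromℕ y δ B)) ⊤ ⟩
    iterate Weak.layer t (Weak.restrict (iterate Weak.layer y δ)) ⊤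
      ≡⟨ Weak.number-iterate y t ⊤ (replicate n 0) ⟨
    Weak.number y (t ℕ.+ y) ⊤ (replicate n 0)
      ≡⟨ fromℕ-Ω (t ℕ.+ y) y ⟨
    fromℕ (Ω P (t ℕ.+ y) (suc y)) ∎

  -- Of the four factors σ, the outermost gives (-1)ⁿ at `⊤`, the middle two meet across the
  -- diagonal restriction and cancel, and the innermost is absorbed by `δ`, supported on the empty
  -- set.
  twoStage-Ω° : ∀ t y → twoStage (- fromℕ t) (- fromℕ y) ≡ (- 1ℚ) ^ n * fromℕ (Ω° P (t ℕ.+ y) y)
  twoStage-Ω° t y = begin
    power (- fromℕ t) (Weak.restrict (power (- fromℕ y) δ)) ⊤
      ≡⟨ negativePower t (Weak.restrict (power (- fromℕ y) δ)) ⊤ ⟩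
    sign (⊤ {n}) * iterate Strict.layer t (λ B → sign B * Weak.restrict (power (- fromℕ y) δ) B) ⊤
      ≡⟨ cong₂ _*_ (sign-⊤ n) (iterate-cong Strict.layer t signs-cancel ⊤) ⟩
    (- 1ℚ) ^ n * iterate Strict.layer t (Strict.restrict (iterate Strict.layer y δ)) ⊤
      ≡⟨ cong ((- 1ℚ) ^ n *_) (trans (fromℕ-Ω° (t ℕ.+ y) y) (Strict.number-iterate y t ⊤ (replicate n 0))) ⟨
    (- 1ℚ) ^ n * fromℕ (Ω° P (t ℕ.+ y) y) ∎
    where
    negativePower : ∀ t f A → power (- fromℕ t) f A ≡ sign A * iterate Strict.layer t (λ B → sign B * f B) A
    negativePower t f A = trans (power-neg signedStrict signedStrict-inverse t f A) (iterate-signedStrict t f A)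
    signs-cancel : ∀ B → sign B * Weak.restrict (power (- fromℕ y) δ) B ≡ Strict.restrict (iterate Strict.layer y δ) B
    signs-cancel B = begin
      sign B * (c * power (- fromℕ y) δ B)
        ≡⟨ cong (λ z → sign B * (c * z)) (trans (negativePower y δ B) (cong (sign B *_) (iterate-cong Strict.layer y sign-δ B))) ⟩
      sign B * (c * (sign B * g))
        ≡⟨ solve 3 (λ s c g → s :* (c :* (s :* g)) := s :* s :* (c :* g)) refl (sign B) c g ⟩
      sign B * sign B * (c * g)
        ≡⟨ cong (_* (c * g)) (sign-square B) ⟩
      1ℚ * (c * g)
        ≡⟨ *-identityˡ (c * g) ⟩
      c * g ∎
      where
      -- Also the factor in `Strict.restrict`: the test depends on `celeste` alone.
      c = ind (Weak.noCeleste? B)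
      g = iterate Strict.layer y δ B

  twoStageᵖ : ∀ {T S} → IsPolynomial T → IsPolynomial S → IsPolynomial (λ x y → twoStage (T x y) (S x y))
  twoStageᵖ {S = S} t s = powerᵖ {F = λ B x y → Weak.restrict (power (S x y) δ) B} t
    (λ B → constᵖ (ind (Weak.noCeleste? B)) *ᵖ powerᵖ {F = λ A x y → δ A} s (λ A → constᵖ (δ A)) B) ⊤

neg-one-square : ∀ n → (- 1ℚ) ^ n * (- 1ℚ) ^ n ≡ 1ℚ
neg-one-square n = trans (cong₂ _*_ (sym (sign-⊤ n)) (sym (sign-⊤ n))) (sign-square (⊤ {n}))

theorem1 : ∀ {n : ℕ} {ℓ : Level} (P : BicoloredPoset n ℓ) →
    ∃[ ω ] ∃[ ω° ]
    IsOrderPolynomial P ω ×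
    IsStrictOrderPolynomial P ω° ×
    (∀ (x y : ℚ) → (- 1ℚ) ^ n * eval₂ ω° (- x) (- y) ≡ eval₂ ω x (y + 1ℚ))
theorem1 {n} P = proj₁ weak , proj₁ strict , isWeak , isStrict , reciprocity
  where
  ε = (- 1ℚ) ^ n

  -- Of the x labels, y - 1 lie below the bound y and x - (y - 1) do not.
  weak : IsPolynomial (λ x y → twoStage P (x - (y - 1ℚ)) (y - 1ℚ))
  weak = twoStageᵖ P (Xᵖ -ᵖ (Yᵖ -ᵖ constᵖ 1ℚ)) (Yᵖ -ᵖ constᵖ 1ℚ)

  -- Here the labels up to y are forbidden to celeste elements, so the exponents are x - y and y,
  -- both negated; `ε` is its own inverse and removes the sign from the count.
  strict : IsPolynomial (λ x y → ε * twoStage P (- (x - y)) (- y))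
  strict = constᵖ ε *ᵖ twoStageᵖ P (-ᵖ (Xᵖ -ᵖ Yᵖ)) (-ᵖ Yᵖ)

  cancel : ∀ q → ε * (ε * q) ≡ q
  cancel q = trans (sym (*-assoc ε ε q)) (trans (cong (_* q) (neg-one-square n)) (*-identityˡ q))

  weak-+ : ∀ t y → eval₂ (proj₁ weak) (fromℕ (t ℕ.+ y)) (fromℕ (suc y)) ≡ fromℕ (Ω P (t ℕ.+ y) (suc y))
  weak-+ t y = begin
    eval₂ (proj₁ weak) (fromℕ (t ℕ.+ y)) (fromℕ (suc y))
      ≡⟨ proj₂ weak (fromℕ (t ℕ.+ y)) (fromℕ (suc y)) ⟩
    twoStage P (fromℕ (t ℕ.+ y) - (fromℕ (suc y) - 1ℚ)) (fromℕ (suc y) - 1ℚ)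
      ≡⟨ cong₂ (twoStage P)
           (trans (cong₂ (λ u v → u - (v - 1ℚ)) (fromℕ-homo-+ t y) (fromℕ-homo-+ 1 y))
                  (solve 2 (λ t y → t :+ y :- (con 1ℚ :+ y :- con 1ℚ) := t) refl (fromℕ t) (fromℕ y)))
           (trans (cong (_- 1ℚ) (fromℕ-homo-+ 1 y))
                  (solve 1 (λ y → con 1ℚ :+ y :- con 1ℚ := y) refl (fromℕ y))) ⟩
    twoStage P (fromℕ t) (fromℕ y)
      ≡⟨ twoStage-Ω P t y ⟩
    fromℕ (Ω P (t ℕ.+ y) (suc y)) ∎

  isWeak : IsOrderPolynomial P (proj₁ weak)
  isWeak x (suc y) _ _ (s≤s y≤x) =
    -- Within the range y ≤ x truncated subtraction is exact, so x is t + y with t = x ∸ y.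
    subst (λ x → eval₂ (proj₁ weak) (fromℕ x) (fromℕ (suc y)) ≡ fromℕ (Ω P x (suc y))) (ℕ.m∸n+n≡m y≤x) (weak-+ (x ℕ.∸ y) y)

  strict-+ : ∀ t y → eval₂ (proj₁ strict) (fromℕ (t ℕ.+ y)) (fromℕ y) ≡ fromℕ (Ω° P (t ℕ.+ y) y)
  strict-+ t y = begin
    eval₂ (proj₁ strict) (fromℕ (t ℕ.+ y)) (fromℕ y)
      ≡⟨ proj₂ strict (fromℕ (t ℕ.+ y)) (fromℕ y) ⟩
    ε * twoStage P (- (fromℕ (t ℕ.+ y) - fromℕ y)) (- fromℕ y)
      ≡⟨ cong (λ z → ε * twoStage P z (- fromℕ y))
           (trans (cong (λ u → - (u - fromℕ y)) (fromℕ-homo-+ t y))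
                  (solve 2 (λ t y → :- (t :+ y :- y) := :- t) refl (fromℕ t) (fromℕ y))) ⟩
    ε * twoStage P (- fromℕ t) (- fromℕ y)
      ≡⟨ cong (ε *_) (twoStage-Ω° P t y) ⟩
    ε * (ε * fromℕ (Ω° P (t ℕ.+ y) y))
      ≡⟨ cancel _ ⟩
    fromℕ (Ω° P (t ℕ.+ y) y) ∎

  isStrict : IsStrictOrderPolynomial P (proj₁ strict)
  isStrict x y _ y≤x =
    subst (λ x → eval₂ (proj₁ strict) (fromℕ x) (fromℕ y) ≡ fromℕ (Ω° P x y)) (ℕ.m∸n+n≡m y≤x) (strict-+ (x ℕ.∸ y) y)

  reciprocity : ∀ (x y : ℚ) → ε * eval₂ (proj₁ strict) (- x) (- y) ≡ eval₂ (proj₁ weak) x (y + 1ℚ)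
  reciprocity x y = begin
    ε * eval₂ (proj₁ strict) (- x) (- y)
      ≡⟨ cong (ε *_) (proj₂ strict (- x) (- y)) ⟩
    ε * (ε * twoStage P (- (- x - - y)) (- - y))
      ≡⟨ cancel _ ⟩
    twoStage P (- (- x - - y)) (- - y)
      -- The second negation undoes the first: the exponents are x - y and y, the weak ones at (x, y
      -- + 1).
      ≡⟨ cong₂ (twoStage P)
           (solve 2 (λ x y → :- (:- x :- (:- y)) := x :- (y :+ con 1ℚ :- con 1ℚ)) refl x y)
           (solve 1 (λ y → :- (:- y) := y :+ con 1ℚ :- con 1ℚ) refl y) ⟩
    twoStage P (x - (y + 1ℚ - 1ℚ)) (y + 1ℚ - 1ℚ)
      ≡⟨ proj₂ weak x (y + 1ℚ) ⟨
    eval₂ (proj₁ weak) x (y + 1ℚ) ∎
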